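{- Let $n\ge 2$. For every index pattern $\mathscr{I}$ of the complete graph $K_n$, the maturity weight of its sprout graph $\mathbb{K}_{n,\mathscr{I}}$ is $$mw(\mathbb{K}_{n,\mathscr{I}})=\sum_{j=1}^{n-1}\sum_{i=j}^{n-1}(n-i)=\sum_{j=1}^{n-1}\sum_{i=1}^{n-j} i .$$
   Context: An index pattern $\mathscr{I}$ of a graph on $n$ vertices is a bijective labelling of its vertices by $v_1,\dots,v_n$ (so the vertices carry the indices $1,\dots,n$). The sprout graph of a graph $G$ with respect to $\mathscr{I}$ is the directed graph on $V(G)$ obtained by replacing every edge $v_iv_j$ of $G$ with $i<j$ by the arc $(v_i,v_j)$. The weight of the arc $(v_i,v_j)$ is $j-i$, and the maturity weight $mw$ of a sprout graph is the sum of the weights of all its arcs. -}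

module Defs where

open import Data.Fin.Base using (Fin; toℕ)
open import Data.Fin.Permutation using (Permutation′; _⟨$⟩ʳ_)
open import Data.Fin.Properties using (_≟_)
open import Data.List.Base using (List; allFin; cartesianProduct; filter; map; upTo)
open import Data.Nat.Base using (ℕ; suc; _+_; _∸_; _<_)
open import Data.Nat.ListAction using (sum)
open import Data.Nat.Properties using (_<?_)
open import Data.Product.Base using (_×_; _,_; uncurry)
open import Function.Base using (_∘_)
open import Level using (0ℓ)
open import Relation.Binary.Core using (Rel)
open import Relation.Binary.Definitions using (Decidable; Irreflexive; Symmetric)
open import Relation.Binary.PropositionalEquality using (_≡_; _≢_; ≢-sym)
open import Relation.Nullary.Decidable using (¬?; _×-dec_)

record Graph (n : ℕ) : Set₁ where
  field
    Adj    : Rel (Fin n) 0ℓ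
    adj?   : Decidable Adj
    symm   : Symmetric Adj
    irrefl : Irreflexive _≡_ Adj

record Digraph (n : ℕ) : Set₁ where
  field
    Arc  : Rel (Fin n) 0ℓ
    arc? : Decidable Arc

  arcs : List (Fin n × Fin n)
  arcs = filter (uncurry arc?) (cartesianProduct (allFin n) (allFin n))

completeGraph : (n : ℕ) → Graph n
completeGraph n = record
  { Adj    = _≢_
  ; adj?   = λ u v → ¬? (u ≟ v)
  ; symm   = ≢-sym
  ; irrefl = λ u≡v u≢v → u≢v u≡v
  }

-- The permutation sends a vertex to its label.
IndexPattern : ℕ → Set
IndexPattern n = Permutation′ n

-- Labels run over 1, …, n, whereas toℕ runs over 0, …, n - 1.
index : ∀ {n} → IndexPattern n → Fin n → ℕ
index I v = suc (toℕ (I ⟨$⟩ʳ v))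

sproutGraph : ∀ {n} → Graph n → IndexPattern n → Digraph n
sproutGraph G I = record
  { Arc  = λ u v → Adj u v × index I u < index I v
  ; arc? = λ u v → adj? u v ×-dec (index I u <? index I v)
  }
  where open Graph G

-- On arcs of a sprout graph the head has the larger index, so the
-- subtraction does not truncate.
weight : ∀ {n} → IndexPattern n → Fin n × Fin n → ℕ
weight I (u , v) = index I v ∸ index I u

maturityWeight : ∀ {n} → Graph n → IndexPattern n → ℕ
maturityWeight G I = sum (map (weight I) (Digraph.arcs (sproutGraph G I)))

-- Sum of f k over a ≤ k ≤ b; both ends are included, and it is 0 if b < a.
sumFromTo : ℕ → ℕ → (ℕ → ℕ) → ℕ
sumFromTo a b f = sum (map (f ∘ (a +_)) (upTo (suc b ∸ a)))

infix 5 sumFromTo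
syntax sumFromTo a b (λ k → e) = ∑[ k from a to b ] e

{-# OPTIONS --safe #-}

-- A pair that is not an arc has truncated weight 0, so the maturity weight is
-- the sum of the truncated differences of the labels over all ordered pairs of
-- vertices. Such a sum is unchanged when the vertices are relabelled, so the
-- index pattern may be taken to be the identity. The vertex labelled j then has
-- out-going weight 1 + 2 + ⋯ + (n - j), which vanishes for j = n.
module Submission where

open import Defs
open import Data.Nat.Base using (ℕ; _∸_; _≤_)
open import Data.Product.Base using (_×_)
open import Relation.Binary.PropositionalEquality using (_≡_)

open import Data.Fin.Base using (Fin; zero; suc; toℕ)
open import Data.Fin.Permutation using (_⟨$⟩ʳ_)
open import Data.List.Base
  using ([]; _∷_; [_]; _++_; map; filter; tabulate; allFin; cartesianProduct;
         applyUpTo; applyDownFrom; upTo; reverse)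
open import Data.List.Properties
  using (map-++; map-∘; map-cong; map-tabulate; map-upTo; applyUpTo-∷ʳ; reverse-applyUpTo)
open import Data.List.Relation.Binary.Permutation.Propositional.Properties
  using (↭-reverse)
open import Data.Nat.Base using (zero; suc; _+_)
open import Data.Nat.ListAction using (sum)
open import Data.Nat.ListAction.Properties using (sum-++; sum-↭)
open import Data.Nat.Properties
  using (+-0-commutativeMonoid; +-identityʳ; ∸-+-assoc; n∸n≡0; m≤n⇒m∸n≡0; ≮⇒≥; <-irrefl)
open import Data.Product.Base using (_,_)
open import Function.Base using (id; _∘_)
open import Relation.Binary.PropositionalEquality
  using (refl; sym; trans; cong; cong₂; _≗_; module ≡-Reasoning)
open import Relation.Nullary.Decidable.Core using (yes; no)
open import Relation.Nullary.Negation.Core using (¬_)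
open import Relation.Unary using (Pred; Decidable)

open import Algebra.Properties.CommutativeMonoid.Sum +-0-commutativeMonoid
  using (sum-cong-≗; sum-permute) renaming (sum to sumFin)

open ≡-Reasoning

-- Serves to drop the arc test from the list of arcs: what is left is a sum over the full product of
-- the vertex set with itself, where each coordinate can be relabelled freely.
sum-map-filter : ∀ {a p} {A : Set a} {P : Pred A p} (P? : Decidable P) (f : A → ℕ) →
  (∀ x → ¬ P x → f x ≡ 0) → ∀ xs → sum (map f (filter P? xs)) ≡ sum (map f xs)
sum-map-filter P? f f≡0 []       = refl
sum-map-filter P? f f≡0 (x ∷ xs) with P? x
... | yes _  = cong (f x +_) (sum-map-filter P? f f≡0 xs)
... | no ¬Px = trans (sum-map-filter P? f f≡0 xs)
                     (cong (_+ sum (map f xs)) (sym (f≡0 x ¬Px)))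

sum-map-cartesianProduct : ∀ {a b} {A : Set a} {B : Set b} (f : A × B → ℕ) xs ys →
  sum (map f (cartesianProduct xs ys)) ≡ sum (map (λ x → sum (map (λ y → f (x , y)) ys)) xs)
sum-map-cartesianProduct f []       ys = refl
sum-map-cartesianProduct f (x ∷ xs) ys = begin
  sum (map f (map (x ,_) ys ++ cartesianProduct xs ys))
    ≡⟨ cong sum (map-++ f (map (x ,_) ys) _) ⟩
  sum (map f (map (x ,_) ys) ++ map f (cartesianProduct xs ys))
    ≡⟨ sum-++ (map f (map (x ,_) ys)) _ ⟩
  sum (map f (map (x ,_) ys)) + sum (map f (cartesianProduct xs ys))
    ≡⟨ cong₂ _+_ (cong sum (sym (map-∘ ys))) (sum-map-cartesianProduct f xs ys) ⟩
  sum (map (λ y → f (x , y)) ys) + sum (map (λ z → sum (map (λ y → f (z , y)) ys)) xs) ∎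

-- Invariance under a permutation is available for sums of functions on `Fin n`, while the theorem
-- speaks of list sums; this lemma and the next two translate between the two forms.
sum-tabulate : ∀ {n} (f : Fin n → ℕ) → sum (tabulate f) ≡ sumFin f
sum-tabulate {zero}  f = refl
sum-tabulate {suc n} f = cong (f zero +_) (sum-tabulate (f ∘ suc))

sum-map-allFin : ∀ {n} (f : Fin n → ℕ) → sum (map f (allFin n)) ≡ sumFin f
sum-map-allFin f = trans (cong sum (map-tabulate id f)) (sum-tabulate f)

sum-toℕ : ∀ n (f : ℕ → ℕ) → sumFin {n} (f ∘ toℕ) ≡ sum (applyUpTo f n)
sum-toℕ zero    f = refl
sum-toℕ (suc n) f = cong (f 0 +_) (sum-toℕ n (f ∘ suc))

sum-applyUpTo-last : ∀ (f : ℕ → ℕ) n →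
  sum (applyUpTo f (suc n)) ≡ sum (applyUpTo f n) + f n
sum-applyUpTo-last f n = begin
  sum (applyUpTo f (suc n))         ≡⟨ cong sum (applyUpTo-∷ʳ f n) ⟨
  sum (applyUpTo f n ++ [ f n ])    ≡⟨ sum-++ (applyUpTo f n) [ f n ] ⟩
  sum (applyUpTo f n) + (f n + 0)   ≡⟨ cong (sum (applyUpTo f n) +_) (+-identityʳ (f n)) ⟩
  sum (applyUpTo f n) + f n         ∎

applyUpTo-∸ : ∀ n → applyUpTo (n ∸_) n ≡ applyDownFrom suc n
applyUpTo-∸ zero    = refl
applyUpTo-∸ (suc n) = cong (suc n ∷_) (applyUpTo-∸ n)

sumFromTo-cong : ∀ a b {f g : ℕ → ℕ} → f ≗ g → sumFromTo a b f ≡ sumFromTo a b g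
sumFromTo-cong a b f≗g = cong sum (map-cong (f≗g ∘ (a +_)) (upTo (suc b ∸ a)))

sumFromTo-1 : ∀ n (f : ℕ → ℕ) → sumFromTo 1 n f ≡ sum (applyUpTo (f ∘ suc) n)
sumFromTo-1 n f = cong sum (map-upTo (f ∘ suc) n)

-- With `i = j + k` the summand becomes `p ∸ k` for `k < p`, so the terms are `p`, ..., 1: the
-- right-hand sum read backwards. For `j > m` both ranges are empty.
sumFromTo-reflect : ∀ m j →
  (∑[ i from j to m ] (suc m ∸ i)) ≡ (∑[ i from 1 to (suc m ∸ j) ] i)
sumFromTo-reflect m j = begin
  sum (map (λ k → suc m ∸ (j + k)) (upTo p))  ≡⟨ cong sum (map-cong (∸-+-assoc (suc m) j) (upTo p)) ⟨
  sum (map (p ∸_) (upTo p))                   ≡⟨ cong sum (map-upTo (p ∸_) p) ⟩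
  sum (applyUpTo (p ∸_) p)                    ≡⟨ cong sum (applyUpTo-∸ p) ⟩
  sum (applyDownFrom suc p)                   ≡⟨ cong sum (reverse-applyUpTo suc p) ⟨
  sum (reverse (applyUpTo suc p))             ≡⟨ sum-↭ (↭-reverse (applyUpTo suc p)) ⟩
  sum (applyUpTo suc p)                       ≡⟨ sumFromTo-1 p id ⟨
  (∑[ i from 1 to p ] i)                      ∎
  where p = suc m ∸ j

-- The terms up to position `a` truncate to 0 and the later ones are 1, 2, .... Each inductive step
-- removes one leading zero.
sum-∸ : ∀ n a → sum (applyUpTo (_∸ a) n) ≡ (∑[ i from 1 to (n ∸ suc a) ] i)
sum-∸ zero    a       = refl
sum-∸ (suc n) zero    = sym (sumFromTo-1 n id)
sum-∸ (suc n) (suc a) = sum-∸ n a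

weight-nonarc : ∀ {n} (I : IndexPattern n) ((u , v) : Fin n × Fin n) →
  ¬ Digraph.Arc (sproutGraph (completeGraph n) I) u v → weight I (u , v) ≡ 0
weight-nonarc I (u , v) ¬arc =
  -- A strict inequality of labels already forces `u ≢ v`, so a pair fails to be an arc only when
  -- `index I v ≤ index I u`.
  m≤n⇒m∸n≡0 (≮⇒≥ λ u<v → ¬arc ((λ { refl → <-irrefl refl u<v }) , u<v))

maturityWeight-allPairs : ∀ {n} (I : IndexPattern n) →
  maturityWeight (completeGraph n) I ≡ sumFin λ u → sumFin λ v → weight I (u , v)
maturityWeight-allPairs {n} I = begin
  maturityWeight (completeGraph n) I
    ≡⟨ sum-map-filter _ (weight I) (weight-nonarc I) (cartesianProduct (allFin n) (allFin n)) ⟩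
  sum (map (weight I) (cartesianProduct (allFin n) (allFin n)))
    ≡⟨ sum-map-cartesianProduct (weight I) (allFin n) (allFin n) ⟩
  sum (map (λ u → sum (map (λ v → weight I (u , v)) (allFin n))) (allFin n))
    ≡⟨ sum-map-allFin (λ u → sum (map (λ v → weight I (u , v)) (allFin n))) ⟩
  sumFin (λ u → sum (map (λ v → weight I (u , v)) (allFin n)))
    ≡⟨ sum-cong-≗ (λ u → sum-map-allFin (λ v → weight I (u , v))) ⟩
  sumFin (λ u → sumFin λ v → weight I (u , v)) ∎

maturityWeight-complete : ∀ m (I : IndexPattern (suc m)) →
  maturityWeight (completeGraph (suc m)) I
    ≡ (∑[ j from 1 to m ] (∑[ i from 1 to (suc m ∸ j) ] i))
maturityWeight-complete m I = begin
  maturityWeight (completeGraph n) I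
    ≡⟨ maturityWeight-allPairs I ⟩
  sumFin (λ u → sumFin λ v → toℕ (I ⟨$⟩ʳ v) ∸ toℕ (I ⟨$⟩ʳ u))
    -- Heads are relabelled first, with the tail `u` fixed; the next step relabels the tails.
    ≡⟨ sum-cong-≗ {n} (λ u → sum-permute (λ b → toℕ b ∸ toℕ (I ⟨$⟩ʳ u)) I) ⟨
  sumFin (λ u → outWeight (I ⟨$⟩ʳ u))
    ≡⟨ sum-permute outWeight I ⟨
  sumFin outWeight
    -- The position `a` counts from 0 and carries the label `suc (toℕ a)`, hence `S ∘ suc`.
    ≡⟨ sum-cong-≗ {n} (λ a → trans (sum-toℕ n (_∸ toℕ a)) (sum-∸ n (toℕ a))) ⟩
  sumFin (S ∘ suc ∘ toℕ {n})
    ≡⟨ sum-toℕ n (S ∘ suc) ⟩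
  sum (applyUpTo (S ∘ suc) n)
    -- There are `n` vertices but the formula stops at `j = m`; the extra term `S n` is an empty
    -- sum.
    ≡⟨ sum-applyUpTo-last (S ∘ suc) m ⟩
  sum (applyUpTo (S ∘ suc) m) + S n
    ≡⟨ cong (λ k → sum (applyUpTo (S ∘ suc) m) + (∑[ i from 1 to k ] i)) (n∸n≡0 n) ⟩
  sum (applyUpTo (S ∘ suc) m) + 0
    ≡⟨ +-identityʳ _ ⟩
  sum (applyUpTo (S ∘ suc) m)
    ≡⟨ sumFromTo-1 m S ⟨
  (∑[ j from 1 to m ] S j) ∎
  where
  n = suc m

  outWeight : Fin n → ℕ
  outWeight a = sumFin {n} λ b → toℕ b ∸ toℕ a

  S : ℕ → ℕ
  S j = ∑[ i from 1 to (n ∸ j) ] i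

proposition4p1 : (n : ℕ) → 2 ≤ n → (I : IndexPattern n) →
    (maturityWeight (completeGraph n) I
    ≡ (∑[ j from 1 to (n ∸ 1) ] (∑[ i from j to (n ∸ 1) ] (n ∸ i))))
    × ((∑[ j from 1 to (n ∸ 1) ] (∑[ i from j to (n ∸ 1) ] (n ∸ i)))
    ≡ (∑[ j from 1 to (n ∸ 1) ] (∑[ i from 1 to (n ∸ j) ] i)))
proposition4p1 (suc m) _ I =
  -- The count yields the second double sum, and `reflect` carries it back to the first.
  trans (maturityWeight-complete m I) (sym reflect) , reflect
  where reflect = sumFromTo-cong 1 m (sumFromTo-reflect m)
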